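{- Let $n\ge1$. Let $L_n$ be the set of closed lattice walks of length $2n$ from $(0,0)$ to $(0,0)$ with steps $E=(1,0)$, $W=(-1,0)$, $N=(0,1)$, $S=(0,-1)$, all of whose points $(x,y)$ satisfy $x\ge y$, and in which every step $N$ is immediately followed by a (possibly empty) run of consecutive $W$ steps and then one step $S$. Let $P_n$ be the set of lattice paths from $(0,0)$ to $(2n,n)$ with steps $E=(1,0)$ and $N=(0,1)$ all of whose points $(x,y)$ satisfy $y\le x/2$. Let $\tau$ be the map on step words that replaces each step of a walk in $L_n$ (read from left to right) according to $E\mapsto EE$, $W\mapsto N$, $N\mapsto EN$, $S\mapsto E$. Then $\tau$ is a bijection from $L_n$ onto $P_n$, and $$|L_n|=|P_n|=|\mathcal{M}_n(12312)|=\frac{1}{2n+1}\binom{3n}{n},$$ where $\mathcal{M}_n(12312)$ is the set of matchings on $[2n]$ avoiding the pattern $12312$.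
   Context: A matching on $[2n]$ is a partition of $[2n]$ into $n$ blocks of size two (edges). The canonical sequential form of a matching with $n$ edges is the word of length $2n$ obtained by labeling edges $1,\dots,n$ in increasing order of their smaller elements and writing at each position the label of the edge containing it. Words $a_1\cdots a_k$, $b_1\cdots b_k$ are order-isomorphic if $a_i<a_j\iff b_i<b_j$ for all $i,j$. A matching contains a pattern $\tau$ if its canonical sequential form has a subsequence order-isomorphic to $\tau$, and avoids $\tau$ otherwise. -}

module Defs where

open import Data.Nat using (ℕ; zero; suc; _+_; _*_; _≤_; _<_; _⊓_)
open import Data.Integer as ℤ using (ℤ; +_)
open import Data.Fin as F using (Fin; toℕ)
open import Data.Vec using (Vec; lookup; _∷_; [])
open import Data.List using (List; []; _∷_; _++_; replicate; length; concatMap; filter; allFin)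
open import Data.List.Relation.Unary.All using (All)
open import Data.List.Relation.Unary.Unique.Propositional using (Unique)
open import Data.List.Membership.Propositional using (_∈_)
open import Data.Product using (Σ; ∃; ∃-syntax; _×_; _,_)
open import Relation.Binary.PropositionalEquality using (_≡_; _≢_)
open import Relation.Nullary using (¬_)
open import Relation.Nullary.Decidable using (_×-dec_)
open import Data.Fin.Properties using () renaming (_<?_ to _<ᶠ?_; _≤?_ to _≤ᶠ?_)
open import Data.Nat.Properties using (_≤?_)

record HasCard {A : Set} (P : A → Set) (k : ℕ) : Set where
  field
    elems    : List A
    unique   : Unique elems
    len      : length elems ≡ k
    sound    : ∀ x → x ∈ elems → P x
    complete : ∀ x → P x → x ∈ elems

data Step : Set where
  E W N S : Step

move : ℤ × ℤ → Step → ℤ × ℤ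
move (x , y) E = (x ℤ.+ + 1 , y)
move (x , y) W = (x ℤ.- + 1 , y)
move (x , y) N = (x , y ℤ.+ + 1)
move (x , y) S = (x , y ℤ.- + 1)

points : ℤ × ℤ → List Step → List (ℤ × ℤ)
points p []      = p ∷ []
points p (s ∷ w) = p ∷ points (move p s) w

endpoint : ℤ × ℤ → List Step → ℤ × ℤ
endpoint p []      = p
endpoint p (s ∷ w) = endpoint (move p s) w

origin : ℤ × ℤ
origin = (+ 0 , + 0)

BelowDiag : ℤ × ℤ → Set
BelowDiag (x , y) = y ℤ.≤ x

NWSProperty : List Step → Set
NWSProperty w = ∀ u v → w ≡ u ++ N ∷ v →
  ∃[ k ] ∃[ rest ] v ≡ replicate k W ++ S ∷ rest

InL : ℕ → List Step → Set
InL n w = length w ≡ 2 * n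
        × endpoint origin w ≡ origin
        × All BelowDiag (points origin w)
        × NWSProperty w

data PStep : Set where
  pE pN : PStep

pmove : ℕ × ℕ → PStep → ℕ × ℕ
pmove (x , y) pE = (suc x , y)
pmove (x , y) pN = (x , suc y)

ppoints : ℕ × ℕ → List PStep → List (ℕ × ℕ)
ppoints p []      = p ∷ []
ppoints p (s ∷ w) = p ∷ ppoints (pmove p s) w

pendpoint : ℕ × ℕ → List PStep → ℕ × ℕ
pendpoint p []      = p
pendpoint p (s ∷ w) = pendpoint (pmove p s) w

BelowHalf : ℕ × ℕ → Set
BelowHalf (x , y) = 2 * y ≤ x

InP : ℕ → List PStep → Set
InP n p = pendpoint (0 , 0) p ≡ (2 * n , n)
        × All BelowHalf (ppoints (0 , 0) p)

τstep : Step → List PStep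
τstep E = pE ∷ pE ∷ []
τstep W = pN ∷ []
τstep N = pE ∷ pN ∷ []
τstep S = pE ∷ []

τ : List Step → List PStep
τ = concatMap τstep

-- Matchings on [2n] (positions Fin (2n)), given as the fixed-point-free
-- involution σ sending each point to its partner in its block.

IsMatching : (m : ℕ) → Vec (Fin m) m → Set
IsMatching m σ = ∀ i → lookup σ (lookup σ i) ≡ i × lookup σ i ≢ i

-- canonical sequential form: the label of the edge containing i is the
-- number of edges whose smaller element is ≤ the smaller element of i's edge
-- (edges labelled 1,…,n by increasing smaller elements)
label : {m : ℕ} → Vec (Fin m) m → Fin m → ℕ
label {m} σ i =
  length (filter (λ j → (_<ᶠ?_ j (lookup σ j)) ×-dec (toℕ j ≤? (toℕ i ⊓ toℕ (lookup σ i)))) (allFin m))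

ContainsPattern : {m k : ℕ} → (Fin m → ℕ) → Vec ℕ k → Set
ContainsPattern {m} {k} w p =
  Σ (Fin k → Fin m) λ f →
    (∀ a b → a F.< b → f a F.< f b)
    × (∀ a b → (lookup p a < lookup p b → w (f a) < w (f b))
             × (w (f a) < w (f b) → lookup p a < lookup p b))

pat12312 : Vec ℕ 5
pat12312 = 1 ∷ 2 ∷ 3 ∷ 1 ∷ 2 ∷ []

InM12312 : (n : ℕ) → Vec (Fin (2 * n)) (2 * n) → Set
InM12312 n σ = IsMatching (2 * n) σ × ¬ ContainsPattern (label σ) pat12312

{-# OPTIONS --safe #-}
-- Measured by the height x − 2 y, the paths of P_n have steps +1 and −2 and stay nonnegative, while τ reads a walk
-- of L_n at (x , y) as the height 2 x − y; since each N is undone by its own S, y ∈ {0 , 1} and y is the parity of the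
-- height, so τ can be inverted from left to right.
-- A matching avoids 12312 iff, whenever edges (a , c) and (b , e) with a < b < c < e cross, no opener lies between b
-- and c. So a closer must close the latest open edge, or else the second latest, and then only if the very last
-- opener is still open. A stack of h open edges corresponds to height 2 h if the last opener is closed and to 2 h − 1
-- if it is open, and then the matchings obey the same recursion as the paths.
-- Counting the paths by their last step instead gives the ballot formula (x + 1 − 2 y) / (x + 1) · C(x + y , y).
module Submission where

open import Defs
open import Data.Nat using (ℕ; zero; suc; _+_; _*_; _∸_; _≤_; _<_; z≤n; s≤s; _⊓_)
open import Data.Nat.Properties
open import Data.Nat.Combinatorics using (_C_; nCk+nC[k+1]≡[n+1]C[k+1])
open import Data.Nat.Solver using (module +-*-Solver)
open import Data.Integer as ℤ using (ℤ; +_; -[1+_])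
import Data.Integer.Properties as ℤ
open import Data.Fin as F using (Fin; zero; suc; toℕ; fromℕ<; #_)
import Data.Fin.Properties as F
open import Data.Vec using (Vec; lookup; tabulate; []; _∷_)
open import Data.Vec.Properties using (lookup∘tabulate; tabulate∘lookup; tabulate-cong)
open import Data.Product using (∃-syntax; _×_; _,_; proj₁; proj₂)
open import Data.Product.Properties using (,-injective)
open import Data.Sum using (_⊎_; inj₁; inj₂; [_,_]′)
open import Data.Empty using (⊥; ⊥-elim)
open import Data.List using (List; []; _∷_; _++_; _∷ʳ_; map; length; replicate; filter; allFin; InitLast; initLast; _∷ʳ′_)
open import Data.List.Properties using (length-map; length-++; ∷-injective; ∷-injectiveʳ; ∷ʳ-injectiveˡ; ∷ʳ-injectiveʳ)
open import Data.List.Relation.Unary.All as All using (All; []; _∷_)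
import Data.List.Relation.Unary.All.Properties as All
open import Data.List.Relation.Unary.Any using (here; there)
open import Data.List.Relation.Unary.AllPairs using (AllPairs; []; _∷_)
open import Data.List.Relation.Unary.Unique.Propositional using (Unique)
import Data.List.Relation.Unary.Unique.Propositional.Properties as Unique
open import Data.List.Membership.Propositional using (_∈_)
open import Data.List.Membership.Propositional.Properties using (∈-map⁺; ∈-map⁻; ∈-++⁺ˡ; ∈-++⁺ʳ; ∈-++⁻; ∈-allFin)
open import Data.List.Membership.Propositional.Properties.WithK using (unique∧set⇒bag)
open import Data.List.Relation.Binary.BagAndSetEquality using (∼bag⇒↭)
open import Data.List.Relation.Binary.Permutation.Propositional.Properties using (↭-length)
open import Function using (_∘_; id; mk⇔)
open import Relation.Nullary using (¬_; yes; no)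
open import Relation.Nullary.Decidable using (_×-dec_)
open import Relation.Unary using (Decidable)
open import Relation.Binary.Definitions using (tri<; tri≈; tri>)
open import Relation.Binary.PropositionalEquality using (_≡_; _≢_; refl; sym; trans; cong; cong₂; subst; subst₂; module ≡-Reasoning)

private
  variable
    A B : Set
    P Q R : A → Set
    k l : ℕ

-- Cardinalities of predicates

-- Duplicate-free lists with the same members are permutations of each other. This later identifies
-- two different counts of the same paths.
card-unique : HasCard P k → HasCard P l → k ≡ l
card-unique c d = trans (sym C.len) (trans (↭-length (∼bag⇒↭ bag)) D.len)
  where
  module C = HasCard c
  module D = HasCard d
  bag = unique∧set⇒bag C.unique D.unique
    (mk⇔ (λ x∈ → D.complete _ (C.sound _ x∈)) (λ x∈ → C.complete _ (D.sound _ x∈)))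

card-∅ : (∀ x → ¬ P x) → HasCard P 0
card-∅ ¬p = record
  { elems = [] ; unique = [] ; len = refl ; sound = λ _ () ; complete = λ x px → ⊥-elim (¬p x px) }

card-singleton : ∀ a → P a → (∀ x → P x → x ≡ a) → HasCard P 1
card-singleton {P = P} a pa only = record
  { elems = a ∷ [] ; unique = [] ∷ [] ; len = refl
  ; sound = λ { x (here x≡a) → subst P (sym x≡a) pa }
  ; complete = λ x px → here (only x px) }

card-image : (f : A → B) → (∀ {x y} → f x ≡ f y → x ≡ y) →
  (∀ x → P x → Q (f x)) → (∀ y → Q y → ∃[ x ] P x × y ≡ f x) →
  HasCard P k → HasCard Q k
card-image {Q = Q} f inj to from c = record
  { elems = map f C.elems
  ; unique = Unique.map⁺ inj C.unique
  ; len = trans (length-map f C.elems) C.len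
  ; sound = λ y y∈ → let x , x∈ , y≡fx = ∈-map⁻ f y∈ in subst Q (sym y≡fx) (to x (C.sound x x∈))
  ; complete = λ y qy → let x , px , y≡fx = from y qy in
      subst (_∈ map f C.elems) (sym y≡fx) (∈-map⁺ f (C.complete x px)) }
  where module C = HasCard c

card-cong : (∀ x → P x → Q x) → (∀ x → Q x → P x) → HasCard P k → HasCard Q k
card-cong to from = card-image id id to (λ x qx → x , from x qx , refl)

-- The list for `Q` is made of chosen preimages, so injectivity matters only on `Q`. This fits `τ`,
-- which sends both E and SS to EE.
card-preimage : (f : A → B) → (∀ x → Q x → P (f x)) →
  (∀ x y → Q x → Q y → f x ≡ f y → x ≡ y) → (∀ y → P y → ∃[ x ] Q x × f x ≡ y) →
  HasCard P k → HasCard Q k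
card-preimage {A = A} {B = B} {Q = Q} {P = P} f to inj onto c = record
  { elems = xs
  ; unique = Unique.map⁻ (subst Unique (sym map≡) C.unique)
  ; len = trans (sym (length-map f xs)) (trans (cong length map≡) C.len)
  ; sound = λ x → All.lookup allQ
  ; complete = λ x qx →
      let x′ , x′∈ , fx≡fx′ = ∈-map⁻ f (subst (f x ∈_) (sym map≡) (C.complete (f x) (to x qx)))
      in subst (_∈ xs) (sym (inj x x′ qx (All.lookup allQ x′∈) fx≡fx′)) x′∈ }
  where
  module C = HasCard c
  lift : (ys : List B) → All P ys → ∃[ xs ] All Q xs × map f xs ≡ ys
  lift [] [] = [] , [] , refl
  lift (y ∷ ys) (py ∷ pys) with onto y py | lift ys pys
  ... | x , qx , refl | xs , qxs , refl = x ∷ xs , qx ∷ qxs , refl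
  lifted = lift C.elems (All.tabulate (λ {y} → C.sound y))
  xs = proj₁ lifted
  allQ = proj₁ (proj₂ lifted)
  map≡ = proj₂ (proj₂ lifted)

card-∪ : (∀ x → P x → Q x → ⊥) → (∀ x → R x → P x ⊎ Q x) →
  (∀ x → P x → R x) → (∀ x → Q x → R x) →
  HasCard P k → HasCard Q l → HasCard R (k + l)
card-∪ disj split p⊆r q⊆r c d = record
  { elems = C.elems ++ D.elems
  ; unique = Unique.++⁺ C.unique D.unique (λ {x} (x∈c , x∈d) → disj x (C.sound x x∈c) (D.sound x x∈d))
  ; len = trans (length-++ C.elems) (cong₂ _+_ C.len D.len)
  ; sound = λ x x∈ → [ (λ i → p⊆r x (C.sound x i)) , (λ i → q⊆r x (D.sound x i)) ]′ (∈-++⁻ C.elems x∈)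
  ; complete = λ x rx → [ (λ px → ∈-++⁺ˡ (C.complete x px)) , (λ qx → ∈-++⁺ʳ C.elems (D.complete x qx)) ]′ (split x rx) }
  where
  module C = HasCard c
  module D = HasCard d

card-∪-image : (f g : A → B) →
  (∀ {x y} → f x ≡ f y → x ≡ y) → (∀ {x y} → g x ≡ g y → x ≡ y) → (∀ x y → f x ≢ g y) →
  (∀ x → P x → R (f x)) → (∀ x → Q x → R (g x)) →
  (∀ y → R y → (∃[ x ] P x × y ≡ f x) ⊎ (∃[ x ] Q x × y ≡ g x)) →
  HasCard P k → HasCard Q l → HasCard R (k + l)
card-∪-image {R = R} f g f-inj g-inj f≢g to₁ to₂ from c d =
  card-∪ (λ { _ (x , _ , refl) (y , _ , eq) → f≢g x y eq }) from
    (λ { _ (x , px , refl) → to₁ x px }) (λ { _ (x , qx , refl) → to₂ x qx })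
    (card-image f f-inj (λ x px → x , px , refl) (λ _ → id) c)
    (card-image g g-inj (λ x qx → x , qx , refl) (λ _ → id) d)

-- Paths below y = x / 2 as descents of their height

double : ℕ → ℕ
double zero = zero
double (suc h) = suc (suc (double h))

double≡2* : ∀ n → double n ≡ 2 * n
double≡2* zero = refl
double≡2* (suc n) = cong suc (trans (cong suc (double≡2* n)) (sym (+-suc n (n + 0))))

double≥ : ∀ n → n ≤ double n
double≥ zero = z≤n
double≥ (suc n) = s≤s (m≤n⇒m≤1+n (double≥ n))

-- Paths from height H to height 0, where the height of (x , y) is x − 2y.
data Descent : ℕ → List PStep → Set where
  done : Descent 0 []
  east : ∀ {H p} → Descent (suc H) p → Descent H (pE ∷ p)
  north : ∀ {H p} → Descent H p → Descent (suc (suc H)) (pN ∷ p)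

norths : List PStep → ℕ
norths [] = 0
norths (pE ∷ p) = norths p
norths (pN ∷ p) = suc (norths p)

-- Only N steps lower the height, each by two. In the base cases of the count this excludes descents
-- with too few N steps.
height≤norths : ∀ {H p} → Descent H p → H ≤ double (norths p)
height≤norths done = z≤n
height≤norths (east d) = ≤-trans (n≤1+n _) (height≤norths d)
height≤norths (north d) = s≤s (s≤s (height≤norths d))

north-shift : ∀ y H → 2 * y + suc (suc H) ≡ 2 * suc y + H
north-shift = solve 2 (λ y H → con 2 :* y :+ (con 2 :+ H) := con 2 :* (con 1 :+ y) :+ H) refl
  where open +-*-Solver

-- The invariant x = 2 y + `H` turns the bound y ≤ x / 2 into the existence of a natural number `H`.
descent⇒below : ∀ {H p} x y → x ≡ 2 * y + H → Descent H p → All BelowHalf (ppoints (x , y) p)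
descent⇒below x y refl done = m≤m+n _ _ ∷ []
descent⇒below {H} x y refl (east d) = m≤m+n _ _ ∷ descent⇒below (suc x) y (sym (+-suc (2 * y) H)) d
descent⇒below x y refl (north {H} d) = m≤m+n _ _ ∷ descent⇒below x (suc y) (north-shift y H) d

descent⇒endpoint : ∀ {H p} x y → x ≡ 2 * y + H → Descent H p →
  pendpoint (x , y) p ≡ (2 * (y + norths p) , y + norths p)
descent⇒endpoint x y refl done =
  cong₂ _,_ (trans (+-identityʳ (2 * y)) (cong (2 *_) (sym (+-identityʳ y)))) (sym (+-identityʳ y))
descent⇒endpoint {H} x y refl (east d) = descent⇒endpoint (suc x) y (sym (+-suc (2 * y) H)) d
descent⇒endpoint x y refl (north {H} {p} d) =
  trans (descent⇒endpoint x (suc y) (north-shift y H) d) (cong (λ z → 2 * z , z) (sym (+-suc y (norths p))))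

below⇒descent : ∀ {m} H p x y → x ≡ 2 * y + H → pendpoint (x , y) p ≡ (2 * m , m) →
  All BelowHalf (ppoints (x , y) p) → Descent H p
below⇒descent H [] x y x≡ end _ with ,-injective end
... | refl , refl = subst (λ z → Descent z []) (+-cancelˡ-≡ (2 * y) 0 H (trans (+-identityʳ _) x≡)) done
below⇒descent H (pE ∷ p) x y x≡ end (_ ∷ b) =
  east (below⇒descent (suc H) p (suc x) y (trans (cong suc x≡) (sym (+-suc (2 * y) H))) end b)
below⇒descent H (pN ∷ p) x y x≡ end (_ ∷ b) =
  subst (λ z → Descent z (pN ∷ p)) H′≡
    (north (below⇒descent H′ p x (suc y) (sym (m+[n∸m]≡n top)) end b))
  where
  top : 2 * suc y ≤ x
  top = first b
    where
    first : ∀ {q p} → All BelowHalf (ppoints q p) → BelowHalf q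
    first {p = []} (b ∷ _) = b
    first {p = _ ∷ _} (b ∷ _) = b
  -- By `top`, the bound at the point after the N step, this subtraction is not truncated.
  H′ = x ∸ 2 * suc y
  H′≡ : suc (suc H′) ≡ H
  H′≡ = +-cancelˡ-≡ (2 * y) _ _ (trans (north-shift y H′) (trans (m+[n∸m]≡n top) x≡))

inP⇒descent : ∀ {n p} → InP n p → Descent 0 p × norths p ≡ n
inP⇒descent {n} {p} (end , below) = d , proj₂ (,-injective (trans (sym (descent⇒endpoint 0 0 refl d)) end))
  where d = below⇒descent {n} 0 p 0 0 refl end below

descent⇒inP : ∀ {n p} → Descent 0 p × norths p ≡ n → InP n p
descent⇒inP (d , refl) = descent⇒endpoint 0 0 refl d , descent⇒below 0 0 refl d

-- Counting descents by their first step

-- evenCount r h and oddCount r h count the descents from 2 h and 2 h + 1; r is the number of positions left in the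
-- corresponding matching, which determines the number of N steps left.
mutual
  evenCount : ℕ → ℕ → ℕ
  evenCount zero zero = 1
  evenCount zero (suc h) = 0
  evenCount (suc r) zero = oddCount r zero
  evenCount (suc r) (suc h) = evenCount r h + oddCount r (suc h)

  oddCount : ℕ → ℕ → ℕ
  oddCount zero h = 0
  -- An east step from an odd height keeps `suc r`: in the matching it reads no position and only
  -- gives up closing the second latest open edge.
  oddCount (suc r) zero = evenCount (suc r) 1
  oddCount (suc r) (suc h) = oddCount r h + evenCount (suc r) (suc (suc h))

-- N steps stand for closers: with k edges open and `r` positions left, `r` + k is twice the number
-- of closers to come. Here k is `h` at even and `h` + 1 at odd height.
EvenDescent OddDescent : ℕ → ℕ → List PStep → Set
EvenDescent r h p = Descent (double h) p × double (norths p) ≡ r + h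
OddDescent r h p = Descent (suc (double h)) p × double (norths p) ≡ suc (r + h)

double≢1 : ∀ n → double n ≢ 1
double≢1 zero ()
double≢1 (suc n) ()

suc-+-suc-injective : ∀ {z} r h → suc (suc z) ≡ suc r + suc h → z ≡ r + h
suc-+-suc-injective r h eq = suc-injective (suc-injective (trans eq (cong suc (+-suc r h))))

suc-+-suc-cong : ∀ {z} r h → z ≡ r + h → suc (suc z) ≡ suc r + suc h
suc-+-suc-cong r h eq = trans (cong (λ z → suc (suc z)) eq) (cong suc (sym (+-suc r h)))

card-north-east : {P Q R : List PStep → Set} → HasCard P k → HasCard Q l →
  (∀ p → P p → R (pN ∷ p)) → (∀ p → Q p → R (pE ∷ p)) →
  ¬ R [] → (∀ p → R (pN ∷ p) → P p) → (∀ p → R (pE ∷ p) → Q p) → HasCard R (k + l)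
card-north-east {R = R} c d toN toE ¬[] fromN fromE =
  card-∪-image (pN ∷_) (pE ∷_) ∷-injectiveʳ ∷-injectiveʳ (λ _ _ ()) toN toE
    (λ { [] r → ⊥-elim (¬[] r) ; (pN ∷ p) r → inj₁ (p , fromN p r , refl)
       ; (pE ∷ p) r → inj₂ (p , fromE p r , refl) }) c d

mutual
  card-even : ∀ r h → HasCard (EvenDescent r h) (evenCount r h)
  card-even zero zero = card-singleton [] (done , refl) only
    where
    only : ∀ p → EvenDescent 0 0 p → p ≡ []
    only [] _ = refl
    only (pE ∷ p) (east d , eq) with ≤-trans (height≤norths d) (≤-reflexive eq)
    ... | ()
    only (pN ∷ p) (() , _)
  card-even zero (suc h) = card-∅ λ p (d , eq) →
    1+n≰n (≤-trans (s≤s (s≤s (double≥ h))) (≤-trans (height≤norths d) (≤-reflexive eq)))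
  card-even (suc r) zero = card-image (pE ∷_) ∷-injectiveʳ
    (λ { p (d , eq) → east d , eq })
    (λ { [] (_ , ()) ; (pE ∷ p) (east d , eq) → p , (d , eq) , refl ; (pN ∷ p) (() , _) })
    (card-odd r zero)
  card-even (suc r) (suc h) = card-north-east (card-even r h) (card-odd r (suc h))
    (λ { p (d , eq) → north d , suc-+-suc-cong r h eq })
    (λ { p (d , eq) → east d , eq })
    (λ { (() , _) })
    (λ { p (north d , eq) → d , suc-+-suc-injective r h eq })
    (λ { p (east d , eq) → d , eq })

  card-odd : ∀ r h → HasCard (OddDescent r h) (oddCount r h)
  card-odd zero zero = card-∅ λ p (_ , eq) → double≢1 (norths p) eq
  card-odd zero (suc h) = card-∅ λ p (d , eq) →
    1+n≰n (≤-trans (s≤s (s≤s (s≤s (double≥ h)))) (≤-trans (height≤norths d) (≤-reflexive eq)))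
  card-odd (suc r) zero = card-image (pE ∷_) ∷-injectiveʳ
    (λ { p (d , eq) → east d , trans eq (+-suc (suc r) 0) })
    (λ { [] (() , _) ; (pE ∷ p) (east d , eq) → p , (d , trans eq (sym (+-suc (suc r) 0))) , refl
       ; (pN ∷ p) (() , _) })
    (card-even (suc r) 1)
  card-odd (suc r) (suc h) = card-north-east (card-odd r h) (card-even (suc r) (suc (suc h)))
    (λ { p (d , eq) → north d , trans (cong (λ z → suc (suc z)) eq) (cong (λ z → suc (suc z)) (sym (+-suc r h))) })
    (λ { p (d , eq) → east d , trans eq (+-suc (suc r) (suc h)) })
    (λ { (() , _) })
    (λ { p (north d , eq) → d , suc-injective (suc-injective (trans eq (cong (λ z → suc (suc z)) (+-suc r h)))) })
    (λ { p (east d , eq) → d , trans eq (sym (+-suc (suc r) (suc h))) })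

card-P : ∀ n → HasCard (InP n) (evenCount (2 * n) 0)
card-P n = card-cong
  (λ p (d , eq) → descent⇒inP (d , *-cancelˡ-≡ _ _ 2 (trans (sym (double≡2* _)) (trans eq (+-identityʳ _)))))
  (λ p inP → let d , eq = inP⇒descent inP in
    d , trans (double≡2* _) (trans (cong (2 *_) eq) (sym (+-identityʳ _))))
  (card-even (2 * n) 0)

-- Counting paths by their last step: the ballot formula

pendpoint-∷ʳ : ∀ q p s → pendpoint q (p ∷ʳ s) ≡ pmove (pendpoint q p) s
pendpoint-∷ʳ q [] s = refl
pendpoint-∷ʳ q (t ∷ p) s = pendpoint-∷ʳ (pmove q t) p s

ppoints-∷ʳ : ∀ q p s → ppoints q (p ∷ʳ s) ≡ ppoints q p ∷ʳ pmove (pendpoint q p) s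
ppoints-∷ʳ q [] s = refl
ppoints-∷ʳ q (t ∷ p) s = cong (q ∷_) (ppoints-∷ʳ (pmove q t) p s)

all-ppoints-endpoint : ∀ {F : ℕ × ℕ → Set} q p → All F (ppoints q p) → F (pendpoint q p)
all-ppoints-endpoint q [] (f ∷ _) = f
all-ppoints-endpoint q (t ∷ p) (_ ∷ fs) = all-ppoints-endpoint (pmove q t) p fs

-- Generalises `InP n`, which is the case `(2 * n , n)`, so that dropping the last step stays within
-- the family.
PathTo : ℕ × ℕ → List PStep → Set
PathTo q p = pendpoint (0 , 0) p ≡ q × All BelowHalf (ppoints (0 , 0) p)

pathTo-below : ∀ {q} p → PathTo q p → BelowHalf q
pathTo-below p (refl , b) = all-ppoints-endpoint _ p b

pathTo-∷ʳ⁺ : ∀ {q} p s → BelowHalf (pmove q s) → PathTo q p → PathTo (pmove q s) (p ∷ʳ s)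
pathTo-∷ʳ⁺ p s below (refl , b) =
  pendpoint-∷ʳ _ p s , subst (All BelowHalf) (sym (ppoints-∷ʳ _ p s)) (All.∷ʳ⁺ b below)

pathTo-∷ʳ⁻ : ∀ {q} p s → PathTo q (p ∷ʳ s) →
  pmove (pendpoint (0 , 0) p) s ≡ q × PathTo (pendpoint (0 , 0) p) p
pathTo-∷ʳ⁻ p s (end , b) =
  trans (sym (pendpoint-∷ʳ _ p s)) end ,
  refl , proj₁ (All.∷ʳ⁻ (subst (All BelowHalf) (ppoints-∷ʳ _ p s) b))

card-pathTo-x,0 : ∀ x → HasCard (PathTo (x , 0)) 1
card-pathTo-x,0 zero = card-singleton [] (refl , z≤n ∷ []) λ p to → only p (initLast p) to
  where
  only : ∀ p → InitLast p → PathTo (0 , 0) p → p ≡ []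
  only _ [] _ = refl
  only _ (p ∷ʳ′ pE) to with pathTo-∷ʳ⁻ p pE to
  ... | () , _
  only _ (p ∷ʳ′ pN) to with pathTo-∷ʳ⁻ p pN to
  ... | () , _
card-pathTo-x,0 (suc x) = card-image (_∷ʳ pE) (∷ʳ-injectiveˡ _ _)
  (λ p → pathTo-∷ʳ⁺ p pE z≤n) (λ p → from p (initLast p)) (card-pathTo-x,0 x)
  where
  from : ∀ p → InitLast p → PathTo (suc x , 0) p → ∃[ q ] PathTo (x , 0) q × p ≡ q ∷ʳ pE
  from _ [] (() , _)
  from _ (p ∷ʳ′ pE) to with pathTo-∷ʳ⁻ p pE to
  ... | eq , to′ with ,-injective eq
  ... | x≡ , y≡ = p , (cong₂ _,_ (suc-injective x≡) y≡ , proj₂ to′) , refl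
  from _ (p ∷ʳ′ pN) to with pathTo-∷ʳ⁻ p pN to
  ... | () , _

card-pathTo-step : ∀ {x y} → BelowHalf (suc x , suc y) →
  HasCard (PathTo (x , suc y)) k → HasCard (PathTo (suc x , y)) l →
  HasCard (PathTo (suc x , suc y)) (k + l)
card-pathTo-step {x = x} {y} below =
  card-∪-image (_∷ʳ pE) (_∷ʳ pN) (∷ʳ-injectiveˡ _ _) (∷ʳ-injectiveˡ _ _)
    (λ p q eq → E≢N (∷ʳ-injectiveʳ p q eq))
    (λ p → pathTo-∷ʳ⁺ p pE below) (λ p → pathTo-∷ʳ⁺ p pN below) (λ p → from p (initLast p))
  where
  E≢N : pE ≢ pN
  E≢N ()
  from : ∀ p → InitLast p → PathTo (suc x , suc y) p →
    (∃[ q ] PathTo (x , suc y) q × p ≡ q ∷ʳ pE) ⊎ (∃[ q ] PathTo (suc x , y) q × p ≡ q ∷ʳ pN)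
  from _ [] (() , _)
  from _ (p ∷ʳ′ pE) to with pathTo-∷ʳ⁻ p pE to
  ... | eq , to′ with ,-injective eq
  ... | x≡ , y≡ = inj₁ (p , (cong₂ _,_ (suc-injective x≡) y≡ , proj₂ to′) , refl)
  from _ (p ∷ʳ′ pN) to with pathTo-∷ʳ⁻ p pN to
  ... | eq , to′ with ,-injective eq
  ... | x≡ , y≡ = inj₂ (p , (cong₂ _,_ x≡ (suc-injective y≡) , proj₂ to′) , refl)

-- Absorption identity: Pascal's rule splits the left side, the induction hypothesis absorbs both
-- parts, and Pascal's rule joins them again.
C-absorb : ∀ n k → suc k * (suc n C suc k) ≡ suc n * (n C k)
C-absorb zero zero = refl
C-absorb zero (suc k) = *-zeroʳ (suc (suc k))
C-absorb (suc n) zero = begin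
  1 * (suc (suc n) C 1)               ≡⟨ cong (1 *_) (sym (nCk+nC[k+1]≡[n+1]C[k+1] (suc n) 0)) ⟩
  1 * (1 + suc n C 1)                 ≡⟨ cong (λ z → suc z + 0) (trans (sym (*-identityˡ _)) (C-absorb n 0)) ⟩
  suc (suc n * 1) + 0                 ≡⟨ +-identityʳ _ ⟩
  suc (suc n) * 1                     ∎
  where open ≡-Reasoning
C-absorb (suc n) (suc k) = begin
  suc (suc k) * (suc (suc n) C suc (suc k))
    ≡⟨ cong (suc (suc k) *_) (sym (nCk+nC[k+1]≡[n+1]C[k+1] (suc n) (suc k))) ⟩
  suc (suc k) * (a + b)
    ≡⟨ solve 3 (λ k a b → (con 2 :+ k) :* (a :+ b) := (con 1 :+ k) :* a :+ a :+ (con 2 :+ k) :* b) refl k a b ⟩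
  suc k * a + a + suc (suc k) * b
    ≡⟨ cong₂ (λ u v → u + a + v) (C-absorb n k) (C-absorb n (suc k)) ⟩
  suc n * (n C k) + a + suc n * (n C suc k)
    ≡⟨ solve 4 (λ n c d a → (con 1 :+ n) :* c :+ a :+ (con 1 :+ n) :* d := (con 1 :+ n) :* (c :+ d) :+ a) refl n (n C k) (n C suc k) a ⟩
  suc n * (n C k + n C suc k) + a
    ≡⟨ cong (λ z → suc n * z + a) (nCk+nC[k+1]≡[n+1]C[k+1] n k) ⟩
  suc n * a + a
    ≡⟨ +-comm (suc n * a) a ⟩
  suc (suc n) * a ∎
  where
  open ≡-Reasoning
  open +-*-Solver
  a = suc n C suc k
  b = suc n C suc (suc k)

-- Expand the left side of the absorption identity by Pascal's rule and cancel the common term.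
C-shift : ∀ x y → suc y * ((x + suc y) C suc y) ≡ suc x * ((x + suc y) C y)
C-shift x y = +-cancelˡ-≡ (suc y * b) _ _ (begin
  suc y * b + suc y * a          ≡⟨ sym (*-distribˡ-+ (suc y) b a) ⟩
  suc y * (b + a)                ≡⟨ cong (suc y *_) (nCk+nC[k+1]≡[n+1]C[k+1] (x + suc y) y) ⟩
  suc y * (suc (x + suc y) C suc y) ≡⟨ C-absorb (x + suc y) y ⟩
  suc (x + suc y) * b            ≡⟨ solve 3 (λ x y b → (con 1 :+ (x :+ (con 1 :+ y))) :* b
                                      := (con 1 :+ y) :* b :+ (con 1 :+ x) :* b) refl x y b ⟩
  suc y * b + suc x * b          ∎)
  where
  open ≡-Reasoning
  open +-*-Solver
  a = (x + suc y) C suc y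
  b = (x + suc y) C y

-- The number `d` is the numerator x + 1 - 2 y of the ballot formula, whose denominator is cleared.
-- Both sides vanish on the line `d` = 0 just outside the region, so the recursion also holds on the
-- boundary `d` = 1.
card-pathTo : ∀ x y d → suc x ≡ 2 * y + d →
  ∃[ k ] HasCard (PathTo (x , y)) k × suc x * k ≡ d * ((x + y) C y)
card-pathTo x y zero eq = 0 ,
  card-∅ (λ p to → 1+n≰n (≤-trans (≤-reflexive (trans eq (+-identityʳ _))) (pathTo-below p to))) ,
  *-zeroʳ (suc x)
card-pathTo x zero (suc d) refl = 1 , card-pathTo-x,0 x , refl
card-pathTo zero (suc y) (suc d) eq with suc-injective (trans eq (cong suc (+-suc (y + suc (y + 0)) d)))
... | ()
card-pathTo (suc x) (suc y) (suc d) eq =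
  -- The numerator is `d` + 1 here; dropping a final E lowers it to `d`, dropping a final N raises
  -- it to `d` + 3.
  let k , cardE , k≡ = card-pathTo x (suc y) d x≡
      l , cardN , l≡ = card-pathTo (suc x) y (3 + d) (trans eq (solve 2 (λ y d →
        con 2 :* (con 1 :+ y) :+ (con 1 :+ d) := con 2 :* y :+ (con 3 :+ d)) refl y d))
  in k + l , card-pathTo-step below cardE cardN , formula k l k≡ (trans l≡ (cong (λ z → (3 + d) * (z C y)) (sym (+-suc x y))))
  where
  open +-*-Solver
  x≡ : suc x ≡ 2 * suc y + d
  x≡ = suc-injective (trans eq (+-suc (2 * suc y) d))
  below : 2 * suc y ≤ suc x
  below = subst (2 * suc y ≤_) (sym x≡) (m≤m+n _ d)
  a = (x + suc y) C suc y
  b = (x + suc y) C y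
  pascal : b + a ≡ (suc x + suc y) C suc y
  pascal = nCk+nC[k+1]≡[n+1]C[k+1] (x + suc y) y
  formula : ∀ k l → suc x * k ≡ d * a → suc (suc x) * l ≡ (3 + d) * b →
    suc (suc x) * (k + l) ≡ suc d * ((suc x + suc y) C suc y)
  -- The factor `suc x` lets both formulas be substituted. The added term balances the surplus 2 (x
  -- + 1) `b` by `C-shift`, which avoids subtraction.
  formula k l k≡ l≡ = *-cancelˡ-≡ _ _ (suc x) (+-cancelʳ-≡ (2 * (suc y * a)) _ _ (begin
    X * (suc X * (k + l)) + 2 * (suc y * a)
      ≡⟨ solve 4 (λ X k l z → X :* ((con 1 :+ X) :* (k :+ l)) :+ z := (con 1 :+ X) :* (X :* k) :+ X :* ((con 1 :+ X) :* l) :+ z) refl X k l _ ⟩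
    suc X * (X * k) + X * (suc X * l) + 2 * (suc y * a)
      ≡⟨ cong₂ (λ u v → suc X * u + X * v + 2 * (suc y * a)) k≡ l≡ ⟩
    suc X * (d * a) + X * ((3 + d) * b) + 2 * (suc y * a)
      ≡⟨ cong (λ X → suc X * (d * a) + X * ((3 + d) * b) + 2 * (suc y * a)) x≡ ⟩
    suc X′ * (d * a) + X′ * ((3 + d) * b) + 2 * (suc y * a)
      ≡⟨ solve 4 (λ y d a b → let X = con 2 :* (con 1 :+ y) :+ d in
           (con 1 :+ X) :* (d :* a) :+ X :* ((con 3 :+ d) :* b) :+ con 2 :* ((con 1 :+ y) :* a)
             := X :* ((con 1 :+ d) :* (b :+ a)) :+ con 2 :* (X :* b)) refl y d a b ⟩
    X′ * (suc d * (b + a)) + 2 * (X′ * b)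
      ≡⟨ cong (λ X → X * (suc d * (b + a)) + 2 * (X * b)) (sym x≡) ⟩
    X * (suc d * (b + a)) + 2 * (X * b)
      ≡⟨ cong₂ (λ u v → X * (suc d * u) + 2 * v) pascal (sym (C-shift x y)) ⟩
    X * (suc d * ((suc x + suc y) C suc y)) + 2 * (suc y * a) ∎))
    where
    open ≡-Reasoning
    X = suc x
    X′ = 2 * suc y + d

-- Compares the count by first steps with the ballot formula, whose numerator at (2 n , n) is 1.
evenCount-formula : ∀ n → suc (2 * n) * evenCount (2 * n) 0 ≡ (3 * n) C n
evenCount-formula n with card-pathTo (2 * n) n 1 (+-comm 1 (2 * n))
... | k , c , eq = begin
  suc (2 * n) * evenCount (2 * n) 0 ≡⟨ cong (suc (2 * n) *_) (card-unique (card-P n) c) ⟩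
  suc (2 * n) * k                   ≡⟨ eq ⟩
  1 * ((2 * n + n) C n)             ≡⟨ *-identityˡ _ ⟩
  (2 * n + n) C n                   ≡⟨ cong (_C n) (+-comm (2 * n) n) ⟩
  (3 * n) C n                       ∎
  where open ≡-Reasoning

-- Closed walks and the bijection τ

-- Pending is the state between an N and its S.
mutual
  data Closed : List Step → Set where
    [] : Closed []
    E∷ : ∀ {w} → Closed w → Closed (E ∷ w)
    W∷ : ∀ {w} → Closed w → Closed (W ∷ w)
    S∷ : ∀ {w} → Closed w → Closed (S ∷ w)
    N∷ : ∀ {w} → Pending w → Closed (N ∷ w)

  data Pending : List Step → Set where
    W∷ : ∀ {w} → Pending w → Pending (W ∷ w)
    S∷ : ∀ {w} → Closed w → Pending (S ∷ w)

nws-tail : ∀ {s w} → NWSProperty (s ∷ w) → NWSProperty w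
nws-tail {s} nws u v eq = nws (s ∷ u) v (cong (s ∷_) eq)

mutual
  nws⇒closed : ∀ w → NWSProperty w → Closed w
  nws⇒closed [] nws = []
  nws⇒closed (E ∷ w) nws = E∷ (nws⇒closed w (nws-tail nws))
  nws⇒closed (W ∷ w) nws = W∷ (nws⇒closed w (nws-tail nws))
  nws⇒closed (S ∷ w) nws = S∷ (nws⇒closed w (nws-tail nws))
  nws⇒closed (N ∷ w) nws =
    let k , rest , eq = nws [] w refl in N∷ (nws⇒pending w k rest eq (nws-tail nws))

  nws⇒pending : ∀ w k rest → w ≡ replicate k W ++ S ∷ rest → NWSProperty w → Pending w
  nws⇒pending (s ∷ w) zero rest eq nws with ∷-injective eq
  ... | refl , _ = S∷ (nws⇒closed w (nws-tail nws))
  nws⇒pending (s ∷ w) (suc k) rest eq nws with ∷-injective eq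
  ... | refl , eq′ = W∷ (nws⇒pending w k rest eq′ (nws-tail nws))

pending-run : ∀ {w} → Pending w → ∃[ k ] ∃[ rest ] w ≡ replicate k W ++ S ∷ rest
pending-run (W∷ p) = let k , rest , eq = pending-run p in suc k , rest , cong (W ∷_) eq
pending-run (S∷ c) = 0 , _ , refl

mutual
  closed⇒nws : ∀ {w} → Closed w → NWSProperty w
  closed⇒nws [] [] v ()
  closed⇒nws [] (_ ∷ _) v ()
  closed⇒nws (N∷ p) [] v refl = pending-run p
  closed⇒nws (E∷ c) (_ ∷ u) v eq = closed⇒nws c u v (∷-injectiveʳ eq)
  closed⇒nws (W∷ c) (_ ∷ u) v eq = closed⇒nws c u v (∷-injectiveʳ eq)
  closed⇒nws (S∷ c) (_ ∷ u) v eq = closed⇒nws c u v (∷-injectiveʳ eq)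
  closed⇒nws (N∷ p) (_ ∷ u) v eq = pending⇒nws p u v (∷-injectiveʳ eq)

  pending⇒nws : ∀ {w} → Pending w → NWSProperty w
  pending⇒nws (W∷ p) (_ ∷ u) v eq = pending⇒nws p u v (∷-injectiveʳ eq)
  pending⇒nws (S∷ c) (_ ∷ u) v eq = closed⇒nws c u v (∷-injectiveʳ eq)

-- Every N is undone by its own S, so the walk cannot end above its starting level.
mutual
  closed-descends : ∀ {w} x y → Closed w → proj₂ (endpoint (x , y) w) ℤ.≤ y
  closed-descends x y [] = ℤ.≤-refl
  closed-descends x y (E∷ c) = closed-descends _ y c
  closed-descends x y (W∷ c) = closed-descends _ y c
  closed-descends x y (S∷ c) = ℤ.≤-trans (closed-descends x _ c) (ℤ.i-j≤i y (+ 1))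
  closed-descends x y (N∷ p) = pending-descends x y p

  pending-descends : ∀ {w} x y → Pending w → proj₂ (endpoint (x , y ℤ.+ + 1) w) ℤ.≤ y
  pending-descends x y (W∷ p) = pending-descends _ y p
  pending-descends x y (S∷ {w} c) = subst (λ z → proj₂ (endpoint (x , y ℤ.+ + 1 ℤ.- + 1) w) ℤ.≤ z)
    y+1-1≡y (closed-descends x _ c)
    where
    y+1-1≡y : y ℤ.+ + 1 ℤ.- + 1 ≡ y
    y+1-1≡y = trans (ℤ.+-assoc y (+ 1) (ℤ.- + 1)) (ℤ.+-identityʳ y)

-- Walks of L_n only visit the levels y = 0 and y = 1: Ground x starts at (x , 0), Raised x at (x + 1 , 1).
mutual
  data Ground : ℕ → List Step → Set where
    [] : Ground 0 []
    E∷ : ∀ {x w} → Ground (suc x) w → Ground x (E ∷ w)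
    W∷ : ∀ {x w} → Ground x w → Ground (suc x) (W ∷ w)
    N∷ : ∀ {x w} → Raised x w → Ground (suc x) (N ∷ w)

  data Raised : ℕ → List Step → Set where
    W∷ : ∀ {x w} → Raised x w → Raised (suc x) (W ∷ w)
    S∷ : ∀ {x w} → Ground (suc x) w → Raised x (S ∷ w)

head-points : ∀ {F : ℤ × ℤ → Set} {p} w → All F (points p w) → F p
head-points [] (f ∷ _) = f
head-points (_ ∷ _) (f ∷ _) = f

+-suc-ℤ : ∀ x → + x ℤ.+ + 1 ≡ + suc x
+-suc-ℤ x = cong +_ (+-comm x 1)

mutual
  -- A pending N admits no second N before its S, so level 2 is never reached. An S from level 0
  -- leads to -1, from where `closed-descends` bars the return. A W or N from the diagonal breaks x
  -- ≥ y at once.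
  walk⇒ground : ∀ x w → Closed w → endpoint (+ x , + 0) w ≡ origin →
    All BelowDiag (points (+ x , + 0) w) → Ground x w
  walk⇒ground x [] c end below with ,-injective end
  ... | refl , _ = []
  walk⇒ground x (E ∷ w) (E∷ c) end (_ ∷ below) rewrite +-suc-ℤ x = E∷ (walk⇒ground (suc x) w c end below)
  walk⇒ground zero (W ∷ w) (W∷ c) end (_ ∷ below) with head-points w below
  ... | ()
  walk⇒ground (suc x) (W ∷ w) (W∷ c) end (_ ∷ below) = W∷ (walk⇒ground x w c end below)
  walk⇒ground x (S ∷ w) (S∷ c) end _
    with subst (ℤ._≤ -[1+ 0 ]) (proj₂ (,-injective end)) (closed-descends (+ x) -[1+ 0 ] c)
  ... | ()
  walk⇒ground zero (N ∷ w) (N∷ p) end (_ ∷ below) with head-points w below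
  ... | ℤ.+≤+ ()
  walk⇒ground (suc x) (N ∷ w) (N∷ p) end (_ ∷ below) = N∷ (walk⇒raised x w p end below)

  walk⇒raised : ∀ x w → Pending w → endpoint (+ suc x , + 1) w ≡ origin →
    All BelowDiag (points (+ suc x , + 1) w) → Raised x w
  walk⇒raised zero (W ∷ w) (W∷ p) end (_ ∷ below) with head-points w below
  ... | ℤ.+≤+ ()
  walk⇒raised (suc x) (W ∷ w) (W∷ p) end (_ ∷ below) = W∷ (walk⇒raised x w p end below)
  walk⇒raised x (S ∷ w) (S∷ c) end (_ ∷ below) = S∷ (walk⇒ground (suc x) w c end below)

mutual
  ground-closed : ∀ {x w} → Ground x w → Closed w
  ground-closed [] = []
  ground-closed (E∷ g) = E∷ (ground-closed g)
  ground-closed (W∷ g) = W∷ (ground-closed g)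
  ground-closed (N∷ r) = N∷ (raised-pending r)

  raised-pending : ∀ {x w} → Raised x w → Pending w
  raised-pending (W∷ r) = W∷ (raised-pending r)
  raised-pending (S∷ g) = S∷ (ground-closed g)

mutual
  ground-endpoint : ∀ {x w} → Ground x w → endpoint (+ x , + 0) w ≡ origin
  ground-endpoint [] = refl
  ground-endpoint {x} (E∷ g) rewrite +-suc-ℤ x = ground-endpoint g
  ground-endpoint (W∷ g) = ground-endpoint g
  ground-endpoint (N∷ r) = raised-endpoint r

  raised-endpoint : ∀ {x w} → Raised x w → endpoint (+ suc x , + 1) w ≡ origin
  raised-endpoint (W∷ r) = raised-endpoint r
  raised-endpoint (S∷ g) = ground-endpoint g

mutual
  ground-below : ∀ {x w} → Ground x w → All BelowDiag (points (+ x , + 0) w)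
  ground-below [] = ℤ.+≤+ z≤n ∷ []
  ground-below {x} (E∷ g) rewrite +-suc-ℤ x = ℤ.+≤+ z≤n ∷ ground-below g
  ground-below (W∷ g) = ℤ.+≤+ z≤n ∷ ground-below g
  ground-below (N∷ r) = ℤ.+≤+ z≤n ∷ raised-below r

  raised-below : ∀ {x w} → Raised x w → All BelowDiag (points (+ suc x , + 1) w)
  raised-below (W∷ r) = ℤ.+≤+ (s≤s z≤n) ∷ raised-below r
  raised-below (S∷ g) = ℤ.+≤+ (s≤s z≤n) ∷ ground-below g

inL⇒ground : ∀ {n w} → InL n w → Ground 0 w × length w ≡ 2 * n
inL⇒ground {w = w} (len , end , below , nws) = walk⇒ground 0 w (nws⇒closed w nws) end below , len

ground⇒inL : ∀ {n w} → Ground 0 w × length w ≡ 2 * n → InL n w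
ground⇒inL (g , len) = len , ground-endpoint g , ground-below g , closed⇒nws (ground-closed g)

mutual
  -- The height is 2 X - Y at the point (X , Y): 2 `x` at (`x` , 0), and 2 `x` + 1 at (`x` + 1 , 1).
  τ-ground : ∀ {x w} → Ground x w → Descent (double x) (τ w)
  τ-ground [] = done
  τ-ground (E∷ g) = east (east (τ-ground g))
  τ-ground (W∷ g) = north (τ-ground g)
  τ-ground (N∷ r) = east (north (τ-raised r))

  τ-raised : ∀ {x w} → Raised x w → Descent (suc (double x)) (τ w)
  τ-raised (W∷ r) = north (τ-raised r)
  τ-raised (S∷ g) = east (τ-ground g)

mutual
  -- Exactly W and N have an N in their image. Since the walk ends at the origin, W outnumbers E by
  -- `x` and there are as many N as S. In the raised case both differences are off by one and the
  -- corrections cancel.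
  ground-length : ∀ {x w} → Ground x w → length w + x ≡ 2 * norths (τ w)
  ground-length [] = refl
  ground-length {x} (E∷ {w = w} g) = trans (sym (+-suc (length w) x)) (ground-length g)
  ground-length (W∷ {w = w} g) = double-suc w (ground-length g)
  ground-length (N∷ {w = w} r) = double-suc w (raised-length r)

  raised-length : ∀ {x w} → Raised x w → length w + x ≡ 2 * norths (τ w)
  raised-length (W∷ {w = w} r) = double-suc w (raised-length r)
  raised-length {x} (S∷ {w = w} g) = trans (sym (+-suc (length w) x)) (ground-length g)

  double-suc : ∀ {x} w → length w + x ≡ 2 * norths (τ w) → suc (length w) + suc x ≡ 2 * suc (norths (τ w))
  double-suc {x} w eq = cong suc (trans (+-suc (length w) x) (trans (cong suc eq) (sym (+-suc _ _))))

mutual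
  -- The images EE, N, EN of the steps possible on level 0 form a prefix code, and so do N, E on
  -- level 1; the level is known throughout.
  τ-injective-ground : ∀ {x w w′} → Ground x w → Ground x w′ → τ w ≡ τ w′ → w ≡ w′
  τ-injective-ground [] [] eq = refl
  τ-injective-ground (E∷ g) (E∷ h) eq =
    cong (E ∷_) (τ-injective-ground g h (∷-injectiveʳ (∷-injectiveʳ eq)))
  τ-injective-ground (W∷ g) (W∷ h) eq = cong (W ∷_) (τ-injective-ground g h (∷-injectiveʳ eq))
  τ-injective-ground (N∷ g) (N∷ h) eq =
    cong (N ∷_) (τ-injective-raised g h (∷-injectiveʳ (∷-injectiveʳ eq)))
  τ-injective-ground [] (E∷ _) ()
  τ-injective-ground (E∷ _) [] ()
  τ-injective-ground (E∷ _) (W∷ _) ()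
  τ-injective-ground (E∷ _) (N∷ _) ()
  τ-injective-ground (W∷ _) (E∷ _) ()
  τ-injective-ground (W∷ _) (N∷ _) ()
  τ-injective-ground (N∷ _) (E∷ _) ()
  τ-injective-ground (N∷ _) (W∷ _) ()

  τ-injective-raised : ∀ {x w w′} → Raised x w → Raised x w′ → τ w ≡ τ w′ → w ≡ w′
  τ-injective-raised (W∷ g) (W∷ h) eq = cong (W ∷_) (τ-injective-raised g h (∷-injectiveʳ eq))
  τ-injective-raised (S∷ g) (S∷ h) eq = cong (S ∷_) (τ-injective-ground g h (∷-injectiveʳ eq))
  τ-injective-raised (W∷ _) (S∷ _) ()
  τ-injective-raised (S∷ _) (W∷ _) ()

mutual
  -- Decoding never gets stuck: after an E from an even height the path is at positive height and
  -- must go on, and an N needs height at least 2, which forces the `suc x` that the decoded W or N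
  -- requires.
  τ-onto-ground : ∀ x p → Descent (double x) p → ∃[ w ] Ground x w × τ w ≡ p
  τ-onto-ground zero [] done = [] , [] , refl
  τ-onto-ground x (pE ∷ pE ∷ p) (east (east d)) =
    let w , g , eq = τ-onto-ground (suc x) p d in E ∷ w , E∷ g , cong (λ q → pE ∷ pE ∷ q) eq
  τ-onto-ground (suc x) (pE ∷ pN ∷ p) (east (north d)) =
    let w , r , eq = τ-onto-raised x p d in N ∷ w , N∷ r , cong (λ q → pE ∷ pN ∷ q) eq
  τ-onto-ground (suc x) (pN ∷ p) (north d) =
    let w , g , eq = τ-onto-ground x p d in W ∷ w , W∷ g , cong (pN ∷_) eq

  τ-onto-raised : ∀ x p → Descent (suc (double x)) p → ∃[ w ] Raised x w × τ w ≡ p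
  τ-onto-raised x (pE ∷ p) (east d) =
    let w , g , eq = τ-onto-ground (suc x) p d in S ∷ w , S∷ g , cong (pE ∷_) eq
  τ-onto-raised (suc x) (pN ∷ p) (north d) =
    let w , r , eq = τ-onto-raised x p d in W ∷ w , W∷ r , cong (pN ∷_) eq

τ-maps : ∀ n w → InL n w → InP n (τ w)
τ-maps n w inL =
  let g , len = inL⇒ground {n} inL
  in descent⇒inP {n} (τ-ground g ,
       *-cancelˡ-≡ _ _ 2 (trans (sym (ground-length g)) (trans (+-identityʳ _) len)))

τ-injective : ∀ n w w′ → InL n w → InL n w′ → τ w ≡ τ w′ → w ≡ w′
τ-injective n w w′ inL inL′ = τ-injective-ground (proj₁ (inL⇒ground {n} inL)) (proj₁ (inL⇒ground {n} inL′))

τ-surjective : ∀ n p → InP n p → ∃[ w ] (InL n w × τ w ≡ p)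
τ-surjective n p inP =
  let d , norths≡n = inP⇒descent {n} inP
      w , g , τw≡p = τ-onto-ground 0 p d
  in w , ground⇒inL {n} (g , trans (sym (+-identityʳ _)) (trans (ground-length g)
       (cong (2 *_) (trans (cong norths τw≡p) norths≡n)))) , τw≡p

-- Avoidance of 12312

module _ {A : Set} {P Q : A → Set} (P? : Decidable P) (Q? : Decidable Q) (P⊆Q : ∀ x → P x → Q x) where

  length-filter-⊆ : ∀ xs → length (filter P? xs) ≤ length (filter Q? xs)
  length-filter-⊆ [] = z≤n
  length-filter-⊆ (x ∷ xs) with P? x | Q? x
  ... | yes _  | yes _  = s≤s (length-filter-⊆ xs)
  ... | yes px | no ¬qx = ⊥-elim (¬qx (P⊆Q x px))
  ... | no _   | yes _  = m≤n⇒m≤1+n (length-filter-⊆ xs)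
  ... | no _   | no _   = length-filter-⊆ xs

  length-filter-⊂ : ∀ {x} xs → x ∈ xs → Q x → ¬ P x → length (filter P? xs) < length (filter Q? xs)
  length-filter-⊂ (x ∷ xs) (here refl) qx ¬px with P? x | Q? x
  ... | yes px | _      = ⊥-elim (¬px px)
  ... | no _   | yes _  = s≤s (length-filter-⊆ xs)
  ... | no _   | no ¬qx = ⊥-elim (¬qx qx)
  length-filter-⊂ (y ∷ xs) (there x∈) qx ¬px with P? y | Q? y
  ... | yes _  | yes _  = s≤s (length-filter-⊂ xs x∈ qx ¬px)
  ... | yes py | no ¬qy = ⊥-elim (¬qy (P⊆Q y py))
  ... | no _   | yes _  = m≤n⇒m≤1+n (length-filter-⊂ xs x∈ qx ¬px)
  ... | no _   | no _   = length-filter-⊂ xs x∈ qx ¬px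

adjacent⇒monotone : ∀ {k} (f : Fin (suc k) → ℕ) → (∀ i → f (F.inject₁ i) < f (suc i)) →
  ∀ a b → a F.< b → f a < f b
adjacent⇒monotone {suc k} f step zero (suc zero) _ = step zero
adjacent⇒monotone {suc k} f step zero (suc (suc b)) _ =
  <-trans (step zero) (adjacent⇒monotone (f ∘ suc) (step ∘ suc) zero (suc b) (s≤s z≤n))
adjacent⇒monotone {suc k} f step (suc a) (suc b) (s≤s a<b) =
  adjacent⇒monotone (f ∘ suc) (step ∘ suc) a b a<b

monotone⇒reflects : ∀ {k} (f : Fin k → ℕ) → (∀ a b → a F.< b → f a < f b) →
  ∀ a b → f a < f b → a F.< b
monotone⇒reflects f mono a b fa<fb with F.<-cmp a b
... | tri< a<b _ _ = a<b
... | tri≈ _ refl _ = ⊥-elim (<-irrefl refl fa<fb)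
... | tri> _ _ b<a = ⊥-elim (<-asym fa<fb (mono b a b<a))

module _ {m : ℕ} where

  -- There is no 12312 whose second 1 is at position c.
  Clear : (Fin m → Fin m) → Fin m → Set
  Clear f c = ∀ b d → f c F.< b → c F.< f b → b F.< d → d F.< c → ¬ (d F.< f d)

  -- `label σ i` is by definition the rank of the smaller end of the edge at `i`, so comparing
  -- labels amounts to comparing openers.
  rank : Vec (Fin m) m → ℕ → ℕ
  rank σ t = length (filter (λ j → (j F.<? lookup σ j) ×-dec (toℕ j ≤? t)) (allFin m))

  -- The opener `o′` is itself counted at `o′` but not at `o`.
  rank-< : ∀ σ {o o′ : Fin m} → o F.< o′ → o′ F.< lookup σ o′ → rank σ (toℕ o) < rank σ (toℕ o′)
  rank-< σ {o} {o′} o<o′ op =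
    length-filter-⊂ _ _ (λ x (op , x≤o) → op , ≤-trans x≤o (<⇒≤ o<o′)) _ (∈-allFin o′)
      (op , ≤-refl) (λ (_ , o′≤o) → <⇒≱ o<o′ o′≤o)

  rank-reflects-< : ∀ σ {o o′ : Fin m} → o F.< lookup σ o → rank σ (toℕ o) < rank σ (toℕ o′) → o F.< o′
  rank-reflects-< σ {o} {o′} op lt with F.<-cmp o o′
  ... | tri< o<o′ _ _ = o<o′
  ... | tri≈ _ refl _ = ⊥-elim (<-irrefl refl lt)
  ... | tri> _ _ o′<o = ⊥-elim (<-asym lt (rank-< σ o′<o op))

  rank-injective : ∀ σ {o o′ : Fin m} → o F.< lookup σ o → o′ F.< lookup σ o′ →
    rank σ (toℕ o) ≡ rank σ (toℕ o′) → o ≡ o′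
  rank-injective σ {o} {o′} op op′ eq with F.<-cmp o o′
  ... | tri< o<o′ _ _ = ⊥-elim (<-irrefl eq (rank-< σ o<o′ op′))
  ... | tri≈ _ o≡o′ _ = o≡o′
  ... | tri> _ _ o′<o = ⊥-elim (<-irrefl (sym eq) (rank-< σ o′<o op))

  module _ (σ : Vec (Fin m) m) (matching : IsMatching m σ) where

    private
      f = lookup σ
      involutive : ∀ i → f (f i) ≡ i
      involutive = proj₁ ∘ matching

    label-opener : ∀ o → o F.< f o → label σ o ≡ rank σ (toℕ o)
    label-opener o op = cong (rank σ) (m≤n⇒m⊓n≡m (<⇒≤ op))

    label-partner : ∀ i → label σ (f i) ≡ label σ i
    label-partner i = cong (rank σ) (trans (cong (λ z → toℕ (f i) ⊓ toℕ z) (involutive i)) (⊓-comm (toℕ (f i)) (toℕ i)))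

    opener : ∀ i → ∃[ o ] o F.< f o × label σ i ≡ rank σ (toℕ o) × (o ≡ i ⊎ (o ≡ f i × f i F.< i))
    opener i with F.<-cmp i (f i)
    ... | tri< op _ _ = i , op , label-opener i op , inj₁ refl
    ... | tri≈ _ eq _ = ⊥-elim (proj₂ (matching i) (sym eq))
    ... | tri> _ _ cl = f i , op , trans (sym (label-partner i)) (label-opener (f i) op) , inj₂ (refl , cl)
      where
      op : f i F.< f (f i)
      op = subst (f i F.<_) (sym (involutive i)) cl

    -- Equal labels come from the same opener, and two distinct positions with one opener are the
    -- two ends of its edge.
    same-label : ∀ i j → label σ i ≡ label σ j → i ≢ j → f i ≡ j
    same-label i j eq i≢j with opener i | opener j
    ... | o , op , lab , at | o′ , op′ , lab′ , at′
      with rank-injective σ op op′ (trans (sym lab) (trans eq lab′))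
    ... | refl with at | at′
    ... | inj₁ refl | inj₁ o≡j = ⊥-elim (i≢j o≡j)
    ... | inj₁ refl | inj₂ (o≡fj , _) = trans (cong f o≡fj) (involutive j)
    ... | inj₂ (o≡fi , _) | inj₁ o≡j = trans (sym o≡fi) o≡j
    ... | inj₂ (o≡fi , _) | inj₂ (o≡fj , _) =
      ⊥-elim (i≢j (trans (sym (involutive i)) (trans (cong f (trans (sym o≡fi) o≡fj)) (involutive j))))

    -- The two 1s and the two 2s of an occurrence are edges, but the 3 may be a closer. It is
    -- replaced by the opener `d` of its edge, which lies before the second 1 and, having the larger
    -- label, after the first 2.
    clear⇒avoids : (∀ c → Clear f c) → ¬ ContainsPattern (label σ) pat12312
    clear⇒avoids clear (x , increasing , iso) with opener (x (# 1)) | opener (x (# 2))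
    ... | o₁ , op₁ , lab₁ , at₁ | d , d-op , lab₂ , at₂ =
      clear (x (# 3)) (x (# 1)) d
        (subst (F._< x (# 1)) (sym f[x₃]≡x₀) x₀<x₁) (subst (x (# 3) F.<_) (sym f[x₁]≡x₄) x₃<x₄)
        (x₁<d at₁) (d<x₃ at₂) d-op
      where
      x₀<x₁ = increasing (# 0) (# 1) (s≤s z≤n)
      x₁<x₄ = increasing (# 1) (# 4) (s≤s (s≤s z≤n))
      x₂<x₃ = increasing (# 2) (# 3) (s≤s (s≤s (s≤s z≤n)))
      x₃<x₄ = increasing (# 3) (# 4) (s≤s (s≤s (s≤s (s≤s z≤n))))
      partner : ∀ i j → x i ≢ x j → lookup pat12312 i ≡ lookup pat12312 j → f (x i) ≡ x j
      partner i j xi≢xj eq = same-label (x i) (x j)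
        (≤-antisym (≮⇒≥ λ lt → <-irrefl (sym eq) (proj₂ (iso j i) lt))
                   (≮⇒≥ λ lt → <-irrefl eq (proj₂ (iso i j) lt))) xi≢xj
      f[x₃]≡x₀ : f (x (# 3)) ≡ x (# 0)
      f[x₃]≡x₀ = partner (# 3) (# 0)
        (λ eq → <-irrefl (cong toℕ (sym eq)) (increasing (# 0) (# 3) (s≤s z≤n))) refl
      f[x₁]≡x₄ : f (x (# 1)) ≡ x (# 4)
      f[x₁]≡x₄ = partner (# 1) (# 4) (λ eq → <-irrefl (cong toℕ eq) x₁<x₄) refl
      o₁<d : o₁ F.< d
      o₁<d = rank-reflects-< σ op₁ (subst₂ _<_ lab₁ lab₂ (proj₁ (iso (# 1) (# 2)) (s≤s (s≤s (s≤s z≤n)))))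
      x₁<d : (o₁ ≡ x (# 1) ⊎ (o₁ ≡ f (x (# 1)) × f (x (# 1)) F.< x (# 1))) → x (# 1) F.< d
      x₁<d (inj₁ o₁≡x₁) = subst (F._< d) o₁≡x₁ o₁<d
      x₁<d (inj₂ (_ , fx₁<x₁)) = ⊥-elim (<-asym x₁<x₄ (subst (F._< x (# 1)) f[x₁]≡x₄ fx₁<x₁))
      d<x₃ : (d ≡ x (# 2) ⊎ (d ≡ f (x (# 2)) × f (x (# 2)) F.< x (# 2))) → d F.< x (# 3)
      d<x₃ (inj₁ d≡x₂) = subst (F._< x (# 3)) (sym d≡x₂) x₂<x₃
      d<x₃ (inj₂ (d≡fx₂ , fx₂<x₂)) = subst (F._< x (# 3)) (sym d≡fx₂) (<-trans fx₂<x₂ x₂<x₃)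

    avoids⇒clear : ¬ ContainsPattern (label σ) pat12312 → ∀ c → Clear f c
    avoids⇒clear avoids c b d fc<b c<fb b<d d<c d-op = avoids (lookup xs , increasing , iso)
      where
      xs : Vec (Fin m) 5
      xs = f c ∷ b ∷ d ∷ c ∷ f b ∷ []
      increasing : ∀ a a′ → a F.< a′ → lookup xs a F.< lookup xs a′
      increasing = adjacent⇒monotone (toℕ ∘ lookup xs)
        λ { zero → fc<b ; (suc zero) → b<d ; (suc (suc zero)) → d<c ; (suc (suc (suc zero))) → c<fb }
      openers : Vec (Fin m) 3
      openers = f c ∷ b ∷ d ∷ []
      b-op : b F.< f b
      b-op = <-trans (<-trans b<d d<c) c<fb
      -- The pattern and the labels are both strictly increasing functions of `letter`, which
      -- settles all comparisons at once.
      letter : Fin 5 → Fin 3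
      letter = lookup (# 0 ∷ # 1 ∷ # 2 ∷ # 0 ∷ # 1 ∷ [])
      letter-pattern : ∀ a → lookup pat12312 a ≡ suc (toℕ (letter a))
      letter-pattern zero = refl
      letter-pattern (suc zero) = refl
      letter-pattern (suc (suc zero)) = refl
      letter-pattern (suc (suc (suc zero))) = refl
      letter-pattern (suc (suc (suc (suc zero)))) = refl
      value : Fin 3 → ℕ
      value = rank σ ∘ toℕ ∘ lookup openers
      fc-op : f c F.< f (f c)
      fc-op = subst (f c F.<_) (sym (involutive c)) (<-trans fc<b (<-trans b<d d<c))
      letter-label : ∀ a → label σ (lookup xs a) ≡ value (letter a)
      letter-label zero = label-opener (f c) fc-op
      letter-label (suc zero) = label-opener b b-op
      letter-label (suc (suc zero)) = label-opener d d-op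
      letter-label (suc (suc (suc zero))) = trans (sym (label-partner c)) (label-opener (f c) fc-op)
      letter-label (suc (suc (suc (suc zero)))) = trans (label-partner b) (label-opener b b-op)
      value-monotone : ∀ a a′ → a F.< a′ → value a < value a′
      value-monotone = adjacent⇒monotone value
        λ { zero → rank-< σ fc<b b-op ; (suc zero) → rank-< σ b<d d-op }
      iso : ∀ a a′ → (lookup pat12312 a < lookup pat12312 a′ → label σ (lookup xs a) < label σ (lookup xs a′))
                   × (label σ (lookup xs a) < label σ (lookup xs a′) → lookup pat12312 a < lookup pat12312 a′)
      iso a a′ rewrite letter-pattern a | letter-pattern a′ | letter-label a | letter-label a′ =
        (λ { (s≤s lt) → value-monotone (letter a) (letter a′) lt }) ,
        (λ lt → s≤s (monotone⇒reflects value value-monotone (letter a) (letter a′) lt))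

-- Building a matching from left to right

module _ {m : ℕ} where

  link : (Fin m → Fin m) → Fin m → Fin m → Fin m → Fin m
  link g p j k with k F.≟ p | k F.≟ j
  ... | yes _ | _     = j
  ... | no _  | yes _ = p
  ... | no _  | no _  = g k

  link-p : ∀ g p j → link g p j p ≡ j
  link-p g p j with p F.≟ p
  ... | yes _ = refl
  ... | no p≢p = ⊥-elim (p≢p refl)

  link-j : ∀ g p j → link g p j j ≡ p
  link-j g p j with j F.≟ p | j F.≟ j
  ... | yes j≡p | _ = j≡p
  ... | no _ | yes _ = refl
  ... | no _ | no j≢j = ⊥-elim (j≢j refl)

  link-other : ∀ g p j {k} → k ≢ p → k ≢ j → link g p j k ≡ g k
  link-other g p j {k} k≢p k≢j with k F.≟ p | k F.≟ j
  ... | yes k≡p | _ = ⊥-elim (k≢p k≡p)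
  ... | no _ | yes k≡j = ⊥-elim (k≢j k≡j)
  ... | no _ | no _ = refl

  <⇒≢ᶠ : ∀ {a b : Fin m} → a F.< b → a ≢ b
  <⇒≢ᶠ lt refl = <-irrefl refl lt

  -- The matching restricted to the positions before i, as an involution g whose fixed points before i are the
  -- openers still waiting for a partner; the stack lists these, latest first.
  record Prefix (i : ℕ) (g : Fin m → Fin m) (stack : List (Fin m)) : Set where
    field
      involutive : ∀ k → g (g k) ≡ k
      future     : ∀ k → i ≤ toℕ k → g k ≡ k
      stack⇒open : ∀ {k} → k ∈ stack → toℕ k < i × g k ≡ k
      open⇒stack : ∀ {k} → toℕ k < i → g k ≡ k → k ∈ stack
      descending : AllPairs (λ a b → b F.< a) stack

  -- The completions of a prefix. `clear` starts at `i` because the condition at an earlier closer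
  -- depends on the prefix alone and is checked when that closer is placed.
  record Extends (i : ℕ) (g : Fin m → Fin m) (σ : Vec (Fin m) m) : Set where
    field
      matching : IsMatching m σ
      clear    : ∀ c → i ≤ toℕ c → Clear (lookup σ) c
      agrees   : ∀ k → g k ≢ k → lookup σ k ≡ g k
      pending  : ∀ k → toℕ k < i → g k ≡ k → i ≤ toℕ (lookup σ k)

  -- The last opener before i has already been closed, resp. is the top of the stack.
  Stale : ℕ → (Fin m → Fin m) → List (Fin m) → Set
  Stale i g stack = ∀ {j} → j ∈ stack → ∃[ k ] j F.< k × toℕ k < i × k F.< g k

  Fresh : ℕ → (Fin m → Fin m) → Fin m → Set
  Fresh i g t = ∀ k → t F.< k → toℕ k < i → g k F.< k

  module _ {p : Fin m} {g : Fin m → Fin m} {stack : List (Fin m)} (prefix : Prefix (toℕ p) g stack) where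

    open Prefix prefix

    private
      i = toℕ p

      gp≡p : g p ≡ p
      gp≡p = future p ≤-refl

    prefix-open : Prefix (suc i) g (p ∷ stack)
    prefix-open = record
      { involutive = involutive
      ; future = λ k i<k → future k (<⇒≤ i<k)
      ; stack⇒open = λ { (here refl) → ≤-refl , gp≡p
                       ; (there k∈) → let k<i , gk≡k = stack⇒open k∈ in m≤n⇒m≤1+n k<i , gk≡k }
      ; open⇒stack = open⇒
      ; descending = All.tabulate (proj₁ ∘ stack⇒open) ∷ descending }
      where
      open⇒ : ∀ {k} → toℕ k < suc i → g k ≡ k → k ∈ p ∷ stack
      open⇒ {k} (s≤s k≤i) gk≡k with k F.≟ p
      ... | yes k≡p = here k≡p
      ... | no k≢p = there (open⇒stack (≤∧≢⇒< k≤i (k≢p ∘ F.toℕ-injective)) gk≡k)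

    extends-open : ∀ {σ} → Extends i g σ → p F.< lookup σ p → Extends (suc i) g σ
    extends-open {σ} ext p<σp = record
      { matching = matching
      ; clear = λ c i<c → clear c (<⇒≤ i<c)
      ; agrees = agrees
      ; pending = pend }
      where
      open Extends ext
      pend : ∀ k → toℕ k < suc i → g k ≡ k → suc i ≤ toℕ (lookup σ k)
      pend k (s≤s k≤i) gk≡k with k F.≟ p
      ... | yes refl = p<σp
      ... | no k≢p = ≤∧≢⇒< (pending k k<i gk≡k) λ p≡σk →
        <-asym p<σp (subst (F._< p)
          (trans (sym (proj₁ (matching k))) (cong (lookup σ) (sym (F.toℕ-injective p≡σk)))) k<i)
        where
        k<i : toℕ k < i
        k<i = ≤∧≢⇒< k≤i (k≢p ∘ F.toℕ-injective)

    opens : ∀ {σ} → Extends (suc i) g σ → p F.< lookup σ p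
    opens ext = Extends.pending ext p ≤-refl gp≡p

    extends-open⁻ : ∀ {σ} → Extends (suc i) g σ → Extends i g σ
    extends-open⁻ {σ} ext = record
      { matching = matching
      ; clear = clr
      ; agrees = agrees
      ; pending = λ k k<i gk≡k → <⇒≤ (pending k (m≤n⇒m≤1+n k<i) gk≡k) }
      where
      open Extends ext
      clr : ∀ c → i ≤ toℕ c → Clear (lookup σ) c
      clr c i≤c with c F.≟ p
      ... | no c≢p = clear c (≤∧≢⇒< i≤c (c≢p ∘ F.toℕ-injective ∘ sym))
      -- At an opener the condition is vacuous, as its partner is not to its left.
      ... | yes refl = λ b d σp<b _ b<d d<p _ → <-asym (opens ext) (<-trans σp<b (<-trans b<d d<p))

    -- An earlier partner moved by `g` would be sent to `p` by `g`, although `g` fixes `p`.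
    opens-or-closes : ∀ {σ} → Extends i g σ → p F.< lookup σ p ⊎ lookup σ p ∈ stack
    opens-or-closes {σ} ext with F.<-cmp p (lookup σ p)
    ... | tri< p<σp _ _ = inj₁ p<σp
    ... | tri≈ _ p≡σp _ = ⊥-elim (proj₂ (Extends.matching ext p) (sym p≡σp))
    ... | tri> _ _ σp<p with g (lookup σ p) F.≟ lookup σ p
    ...   | yes fixed = inj₂ (open⇒stack σp<p fixed)
    ...   | no moved = ⊥-elim (proj₂ (matching p) (trans (sym (involutive (lookup σ p))) (trans (cong g (sym p≡gσp)) gp≡p)))
      where
      open Extends ext
      p≡gσp : p ≡ g (lookup σ p)
      p≡gσp = trans (sym (proj₁ (matching p))) (agrees (lookup σ p) moved)

    stays-open : ∀ {σ b} → Extends i g σ → b ∈ stack → lookup σ p ≢ b → p F.< lookup σ b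
    stays-open {σ} {b} ext b∈ σp≢b = let b<i , gb≡b = stack⇒open b∈ in
      ≤∧≢⇒< (pending b b<i gb≡b) λ p≡σb →
        σp≢b (trans (cong (lookup σ) (F.toℕ-injective p≡σb)) (proj₁ (matching b)))
      where open Extends ext

    module _ {j : Fin m} (j∈ : j ∈ stack) where

      private
        g′ = link g p j

        j<p : j F.< p
        j<p = proj₁ (stack⇒open j∈)

        gj≡j : g j ≡ j
        gj≡j = proj₂ (stack⇒open j∈)

        unlinked : ∀ {k} → g k ≢ k → k ≢ p × k ≢ j
        unlinked gk≢k = (λ { refl → gk≢k gp≡p }) , (λ { refl → gk≢k gj≡j })

        fixed : ∀ {k} → g′ k ≡ k → k ≢ p × k ≢ j × g k ≡ k
        fixed {k} eq = k≢p , k≢j , trans (sym (link-other g p j k≢p k≢j)) eq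
          where
          k≢p : k ≢ p
          k≢p refl = <⇒≢ᶠ j<p (trans (sym (link-p g p j)) eq)
          k≢j : k ≢ j
          k≢j refl = <⇒≢ᶠ j<p (trans (sym eq) (link-j g p j))

      prefix-close : ∀ {stack′} → (∀ {k} → k ∈ stack′ → k ∈ stack × k ≢ j) →
        (∀ {k} → k ∈ stack → k ≢ j → k ∈ stack′) → AllPairs (λ a b → b F.< a) stack′ →
        Prefix (suc i) g′ stack′
      prefix-close ⊆ ⊇ desc = record
        { involutive = invol
        ; future = λ k i<k → trans (link-other g p j (<⇒≢ᶠ i<k ∘ sym) (<⇒≢ᶠ (<-trans j<p i<k) ∘ sym)) (future k (<⇒≤ i<k))
        ; stack⇒open = λ {k} k∈′ → let k∈ , k≢j = ⊆ k∈′ ; k<i , gk≡k = stack⇒open k∈ in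
            m≤n⇒m≤1+n k<i , trans (link-other g p j (<⇒≢ᶠ k<i) k≢j) gk≡k
        ; open⇒stack = λ { {k} (s≤s k≤i) eq → let k≢p , k≢j , gk≡k = fixed eq in
            ⊇ (open⇒stack (≤∧≢⇒< k≤i (k≢p ∘ F.toℕ-injective)) gk≡k) k≢j }
        ; descending = desc }
        where
        invol : ∀ k → g′ (g′ k) ≡ k
        invol k with k F.≟ p | k F.≟ j
        ... | yes refl | _ = link-j g p j
        ... | no _ | yes refl = link-p g p j
        ... | no k≢p | no k≢j = trans (link-other g p j
          (λ gk≡p → k≢p (trans (sym (involutive k)) (trans (cong g gk≡p) gp≡p)))
          (λ gk≡j → k≢j (trans (sym (involutive k)) (trans (cong g gk≡j) gj≡j)))) (involutive k)

      closes : ∀ {σ} → Extends (suc i) g′ σ → lookup σ p ≡ j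
      closes ext = trans (Extends.agrees ext p (λ eq → proj₁ (fixed eq) refl)) (link-p g p j)

      extends-close : ∀ {σ} → Extends i g σ → lookup σ p ≡ j → Extends (suc i) g′ σ
      extends-close {σ} ext σp≡j = record
        { matching = matching
        ; clear = λ c i<c → clear c (<⇒≤ i<c)
        ; agrees = agr
        ; pending = λ { k (s≤s k≤i) eq → let k≢p , k≢j , gk≡k = fixed eq in
            stays-open ext (open⇒stack (≤∧≢⇒< k≤i (k≢p ∘ F.toℕ-injective)) gk≡k)
              (λ σp≡k → k≢j (trans (sym σp≡k) σp≡j)) } }
        where
        open Extends ext
        agr : ∀ k → g′ k ≢ k → lookup σ k ≡ g′ k
        agr k g′k≢k with k F.≟ p | k F.≟ j
        ... | yes refl | _ = σp≡j
        ... | no _ | yes refl = trans (cong (lookup σ) (sym σp≡j)) (proj₁ (matching p))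
        ... | no k≢p | no k≢j = agrees k g′k≢k

      extends-close⁻ : ∀ {σ} → Clear (lookup σ) p → Extends (suc i) g′ σ → Extends i g σ
      extends-close⁻ {σ} clear-p ext = record
        { matching = matching
        ; clear = clr
        ; agrees = λ k gk≢k → let k≢p , k≢j = unlinked gk≢k ; g′k≡gk = link-other g p j k≢p k≢j in
            trans (agrees k (λ eq → gk≢k (trans (sym g′k≡gk) eq))) g′k≡gk
        ; pending = pend }
        where
        open Extends ext
        clr : ∀ c → i ≤ toℕ c → Clear (lookup σ) c
        clr c i≤c with c F.≟ p
        ... | no c≢p = clear c (≤∧≢⇒< i≤c (c≢p ∘ F.toℕ-injective ∘ sym))
        ... | yes refl = clear-p
        pend : ∀ k → toℕ k < i → g k ≡ k → i ≤ toℕ (lookup σ k)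
        pend k k<i gk≡k with k F.≟ j
        ... | yes refl = ≤-reflexive (cong toℕ (sym
          (trans (cong (lookup σ) (sym (closes ext))) (proj₁ (matching p)))))
        ... | no k≢j = <⇒≤ (pending k (m≤n⇒m≤1+n k<i) (trans (link-other g p j (<⇒≢ᶠ k<i) k≢j) gk≡k))

      -- Had `g` already matched `b`, the partner would lie beyond `p`, where `g` is still the
      -- identity.
      crosses⇒stack : ∀ {σ b} → Extends (suc i) g′ σ → j F.< b → b F.< p → p F.< lookup σ b → b ∈ stack
      crosses⇒stack {σ} {b} ext j<b b<p p<σb with g b F.≟ b
      ... | yes gb≡b = open⇒stack b<p gb≡b
      ... | no gb≢b = ⊥-elim (gb≢b (trans (sym (future (g b) (<⇒≤ p<gb))) (involutive b)))
        where
        g′b≡gb : g′ b ≡ g b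
        g′b≡gb = link-other g p j (<⇒≢ᶠ b<p) (<⇒≢ᶠ j<b ∘ sym)
        p<gb : p F.< g b
        p<gb = subst (p F.<_) (trans (Extends.agrees ext b (λ eq → gb≢b (trans (sym g′b≡gb) eq))) g′b≡gb) p<σb

  module _ {p : Fin m} {g : Fin m → Fin m} {t : Fin m} {rest : List (Fin m)}
           (prefix : Prefix (toℕ p) g (t ∷ rest)) where

    open Prefix prefix

    private
      i = toℕ p
      t<p : t F.< p
      t<p = proj₁ (stack⇒open (here refl))
      rest<t : ∀ {k} → k ∈ rest → k F.< t
      rest<t k∈ with descending
      ... | t> ∷ _ = All.lookup t> k∈

    prefix-close-top : Prefix (suc i) (link g p t) rest
    prefix-close-top = prefix-close prefix (here refl)
      (λ k∈ → there k∈ , <⇒≢ᶠ (rest<t k∈))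
      (λ { (here k≡t) k≢t → ⊥-elim (k≢t k≡t) ; (there k∈) _ → k∈ }) tail
      where
      tail : AllPairs (λ a b → b F.< a) rest
      tail with descending
      ... | _ ∷ d = d

    -- The opener `t` just closed lies after all that remain open.
    stale-close-top : Stale (suc i) (link g p t) rest
    stale-close-top k∈ = t , rest<t k∈ , m≤n⇒m≤1+n t<p , subst (t F.<_) (sym (link-j g p t)) t<p

    -- An edge crossing (`t` , `p`) from the right would have an open opener after `t`, the latest
    -- one.
    clear-close-top : ∀ {σ} → Extends (suc i) (link g p t) σ → Clear (lookup σ) p
    clear-close-top ext b d σp<b p<σb b<d d<p _
      with subst (F._< b) (closes prefix (here refl) ext) σp<b
    ... | t<b with crosses⇒stack prefix (here refl) ext t<b (<-trans b<d d<p) p<σb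
    ... | here refl = <-irrefl refl t<b
    ... | there b∈ = <-asym t<b (rest<t b∈)

    card-top-or-open : ∀ {a b} → HasCard (Extends (suc i) (link g p t)) a → HasCard (Extends (suc i) g) b →
      HasCard (λ σ → Extends (suc i) (link g p t) σ ⊎ Extends (suc i) g σ) (a + b)
    card-top-or-open = card-∪
      (λ σ c o → <-asym t<p (subst (p F.<_) (closes prefix (here refl) c) (opens prefix o)))
      (λ _ → id) (λ _ → inj₁) (λ _ → inj₂)

    top-or-open⇒extends : ∀ σ → Extends (suc i) (link g p t) σ ⊎ Extends (suc i) g σ → Extends i g σ
    top-or-open⇒extends σ (inj₁ c) = extends-close⁻ prefix (here refl) (clear-close-top c) c
    top-or-open⇒extends σ (inj₂ o) = extends-open⁻ prefix o

    -- An edge closed from below `t` would cross the edge of `t`, and the closed opener `k` between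
    -- `t` and `p` would serve as the 3.
    stale-split : Stale i g (t ∷ rest) → ∀ σ → Extends i g σ → Extends (suc i) (link g p t) σ ⊎ Extends (suc i) g σ
    stale-split stale σ ext with opens-or-closes prefix ext
    ... | inj₁ op = inj₂ (extends-open prefix ext op)
    ... | inj₂ (here σp≡t) = inj₁ (extends-close prefix (here refl) ext σp≡t)
    ... | inj₂ (there σp∈) with stale (here refl)
    ... | k , t<k , k<p , k<gk = ⊥-elim (Extends.clear ext p ≤-refl t k (rest<t σp∈)
      (stays-open prefix ext (here refl) (<⇒≢ᶠ (rest<t σp∈))) t<k k<p
      (subst (k F.<_) (sym (Extends.agrees ext k (<⇒≢ᶠ k<gk ∘ sym))) k<gk))

    -- An edge closed from below the second entry `s` would cross the edge of `s`, with `t` as the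
    -- 3. The entry is given existentially because `rest` may be empty.
    fresh-split : Fresh i g t → ∀ σ → Extends i g σ →
      (∃[ s ] ∃[ rest′ ] rest ≡ s ∷ rest′ × Extends (suc i) (link g p s) σ)
      ⊎ (Extends (suc i) (link g p t) σ ⊎ Extends (suc i) g σ)
    fresh-split fresh σ ext with opens-or-closes prefix ext
    ... | inj₁ op = inj₂ (inj₂ (extends-open prefix ext op))
    ... | inj₂ (here σp≡t) = inj₂ (inj₁ (extends-close prefix (here refl) ext σp≡t))
    ... | inj₂ (there (here σp≡s)) = inj₁ (_ , _ , refl , extends-close prefix (there (here refl)) ext σp≡s)
    ... | inj₂ (there (there {s} σp∈)) with descending
    ... | _ ∷ s> ∷ _ = ⊥-elim (Extends.clear ext p ≤-refl s t σp<s
      (stays-open prefix ext (there (here refl)) (<⇒≢ᶠ σp<s)) (rest<t (here refl)) t<p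
      (<-trans t<p (stays-open prefix ext (here refl) (<⇒≢ᶠ (rest<t (there σp∈))))))
      where
      σp<s : lookup σ p F.< s
      σp<s = All.lookup s> σp∈

  module _ {p : Fin m} {g : Fin m → Fin m} {t s : Fin m} {rest : List (Fin m)}
           (prefix : Prefix (toℕ p) g (t ∷ s ∷ rest)) (fresh : Fresh (toℕ p) g t) where

    open Prefix prefix

    private
      i = toℕ p
      s∈ : s ∈ t ∷ s ∷ rest
      s∈ = there (here refl)
      s<t : s F.< t
      s<t with descending
      ... | (s<t ∷ _) ∷ _ = s<t
      rest<s : ∀ {k} → k ∈ rest → k F.< s
      rest<s k∈ with descending
      ... | _ ∷ s> ∷ _ = All.lookup s> k∈
      t<p : t F.< p
      t<p = proj₁ (stack⇒open (here refl))

    prefix-close-second : Prefix (suc i) (link g p s) (t ∷ rest)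
    prefix-close-second = prefix-close prefix s∈
      (λ { (here refl) → here refl , <⇒≢ᶠ s<t ∘ sym ; (there k∈) → there (there k∈) , <⇒≢ᶠ (rest<s k∈) })
      (λ { (here k≡t) _ → here k≡t ; (there (here k≡s)) k≢s → ⊥-elim (k≢s k≡s) ; (there (there k∈)) _ → there k∈ })
      tail
      where
      tail : AllPairs (λ a b → b F.< a) (t ∷ rest)
      tail with descending
      ... | (_ ∷ t>) ∷ _ ∷ d = t> ∷ d

    fresh-close-second : Fresh (suc i) (link g p s) t
    fresh-close-second k t<k (s≤s k≤i) with k F.≟ p | k F.≟ s
    ... | yes refl | _ = <-trans s<t t<p
    ... | no _ | yes refl = ⊥-elim (<-asym s<t t<k)
    ... | no k≢p | no _ = fresh k t<k (≤∧≢⇒< k≤i (k≢p ∘ F.toℕ-injective))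

    -- The only open opener after `s` is `t`, so only its edge can cross (`s` , `p`); by freshness
    -- every position between `t` and `p` is a closer, so there is no 3.
    clear-close-second : ∀ {σ} → Extends (suc i) (link g p s) σ → Clear (lookup σ) p
    clear-close-second {σ} ext b d σp<b p<σb b<d d<p d<σd
      with subst (F._< b) (closes prefix s∈ ext) σp<b
    ... | s<b with crosses⇒stack prefix s∈ ext s<b (<-trans b<d d<p) p<σb
    ... | there (here refl) = <-irrefl refl s<b
    ... | there (there b∈) = <-asym s<b (rest<s b∈)
    ... | here refl = <-asym d<σd (subst (F._< d) (sym σd≡gd) gd<d)
      where
      gd<d : g d F.< d
      gd<d = fresh d b<d d<p
      g′d≡gd : link g p s d ≡ g d
      g′d≡gd = link-other g p s (<⇒≢ᶠ d<p) (<⇒≢ᶠ (<-trans s<b b<d) ∘ sym)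
      σd≡gd : lookup σ d ≡ g d
      σd≡gd = trans (Extends.agrees ext d (λ eq → <⇒≢ᶠ gd<d (trans (sym g′d≡gd) eq))) g′d≡gd

    card-fresh-step : ∀ {a b} → HasCard (Extends (suc i) (link g p s)) a →
      HasCard (λ σ → Extends (suc i) (link g p t) σ ⊎ Extends (suc i) g σ) b →
      HasCard (Extends i g) (a + b)
    card-fresh-step = card-∪
      (λ { σ c (inj₁ c′) → <⇒≢ᶠ s<t (trans (sym (closes prefix s∈ c)) (closes prefix (here refl) c′))
         ; σ c (inj₂ o) → <-asym (<-trans s<t t<p) (subst (p F.<_) (closes prefix s∈ c) (opens prefix o)) })
      (λ σ ext → split σ (fresh-split prefix fresh σ ext))
      (λ σ c → extends-close⁻ prefix s∈ (clear-close-second c) c)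
      (top-or-open⇒extends prefix)
      where
      split : ∀ σ {B : Set} → (∃[ s′ ] ∃[ rest′ ] s ∷ rest ≡ s′ ∷ rest′ × Extends (suc i) (link g p s′) σ) ⊎ B →
        Extends (suc i) (link g p s) σ ⊎ B
      split σ (inj₁ (_ , _ , refl , c)) = inj₁ c
      split σ (inj₂ o) = inj₂ o

  -- Counting the completions of a prefix

  position : ∀ i r → i + suc r ≡ m → ∃[ p ] toℕ p ≡ i
  position i r eq = fromℕ< i<m , F.toℕ-fromℕ< i<m
    where
    i<m : i < m
    i<m = ≤-trans (s≤s (m≤m+n i r)) (≤-reflexive (trans (sym (+-suc i r)) eq))

  fresh-open : ∀ (p : Fin m) g → Fresh (suc (toℕ p)) g p
  fresh-open p g k p<k (s≤s k≤p) = ⊥-elim (<⇒≱ p<k k≤p)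

  -- An edge still open at the end would need a partner beyond the last position.
  complete-empty : ∀ {i g t rest} → i + 0 ≡ m → Prefix i g (t ∷ rest) → ∀ σ → ¬ Extends i g σ
  complete-empty {i} {t = t} eq prefix σ ext =
    let t<i , gt≡t = Prefix.stack⇒open prefix (here refl) in
    <⇒≱ (F.toℕ<n (lookup σ t))
      (subst (_≤ toℕ (lookup σ t)) (trans (sym (+-identityʳ i)) eq) (Extends.pending ext t t<i gt≡t))

  card-complete : ∀ {i g} → i + 0 ≡ m → Prefix i g [] → HasCard (Extends i g) 1
  card-complete {i} {g} eq prefix = card-singleton (tabulate g)
    record
      { matching = λ k → trans (lookup∘tabulate g _) (trans (cong g (lookup∘tabulate g k)) (involutive k)) ,
          λ fixed → moved k (trans (sym (lookup∘tabulate g k)) fixed)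
      ; clear = λ c i≤c → ⊥-elim (<⇒≱ (all<i c) i≤c)
      ; agrees = λ k _ → lookup∘tabulate g k
      ; pending = λ k _ gk≡k → ⊥-elim (moved k gk≡k) }
    λ σ ext → trans (sym (tabulate∘lookup σ)) (tabulate-cong λ k → Extends.agrees ext k (moved k))
    where
    open Prefix prefix
    all<i : ∀ k → toℕ k < i
    all<i k = subst (toℕ k <_) (trans (sym eq) (+-identityʳ i)) (F.toℕ<n k)
    moved : ∀ k → g k ≢ k
    moved k gk≡k with open⇒stack (all<i k) gk≡k
    ... | ()

  mutual
    card-stale : ∀ r i g stack → i + r ≡ m → Prefix i g stack → Stale i g stack →
      HasCard (Extends i g) (evenCount r (length stack))
    card-stale zero i g [] eq prefix stale = card-complete eq prefix
    card-stale zero i g (t ∷ rest) eq prefix stale = card-∅ (complete-empty eq prefix)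
    card-stale (suc r) i g stack eq prefix stale with position i r eq
    card-stale (suc r) i g [] eq prefix stale | p , refl =
      card-cong (λ _ → extends-open⁻ prefix) split
        (card-fresh r (suc i) g p [] (trans (sym (+-suc i r)) eq) (prefix-open prefix) (fresh-open p g))
      where
      split : ∀ σ → Extends i g σ → Extends (suc i) g σ
      split σ ext with opens-or-closes prefix ext
      ... | inj₁ op = extends-open prefix ext op
    card-stale (suc r) i g (t ∷ rest) eq prefix stale | p , refl =
      card-cong (top-or-open⇒extends prefix) (stale-split prefix stale)
        (card-step r p g t rest eq prefix)

    -- The index is `length rest` because the fresh opener `t` contributes 1 to the height and every
    -- other open edge 2.
    card-fresh : ∀ r i g t rest → i + r ≡ m → Prefix i g (t ∷ rest) → Fresh i g t →
      HasCard (Extends i g) (oddCount r (length rest))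
    card-fresh zero i g t rest eq prefix fresh = card-∅ (complete-empty eq prefix)
    card-fresh (suc r) i g t rest eq prefix fresh with position i r eq
    card-fresh (suc r) i g t [] eq prefix fresh | p , refl =
      card-cong (top-or-open⇒extends prefix) split (card-step r p g t [] eq prefix)
      where
      split : ∀ σ → Extends i g σ → Extends (suc i) (link g p t) σ ⊎ Extends (suc i) g σ
      split σ ext with fresh-split prefix fresh σ ext
      ... | inj₂ c = c
    card-fresh (suc r) i g t (s ∷ rest) eq prefix fresh | p , refl =
      card-fresh-step prefix fresh
        (card-fresh r (suc i) (link g p s) t rest (trans (sym (+-suc i r)) eq)
          (prefix-close-second prefix fresh) (fresh-close-second prefix fresh))
        (card-step r p g t (s ∷ rest) eq prefix)

    -- The sum is `evenCount (suc r) (suc (length rest))` unfolded: the whole count for a stale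
    -- prefix, and the summand behind the extra east step for a fresh one.
    card-step : ∀ r p g t rest → toℕ p + suc r ≡ m → Prefix (toℕ p) g (t ∷ rest) →
      HasCard (λ σ → Extends (suc (toℕ p)) (link g p t) σ ⊎ Extends (suc (toℕ p)) g σ)
        (evenCount r (length rest) + oddCount r (suc (length rest)))
    card-step r p g t rest eq prefix = card-top-or-open prefix
      (card-stale r (suc (toℕ p)) (link g p t) rest eq′ (prefix-close-top prefix) (stale-close-top prefix))
      (card-fresh r (suc (toℕ p)) g p (t ∷ rest) eq′ (prefix-open prefix) (fresh-open p g))
      where eq′ = trans (sym (+-suc (toℕ p) r)) eq

-- At position 0 with `g` = `id`, the fields `agrees` and `pending` are vacuous, as is `Stale` on
-- the empty stack, so `Extends` is avoidance itself.
card-M : ∀ n → HasCard (InM12312 n) (evenCount (2 * n) 0)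
card-M n = card-cong
  (λ σ ext → let open Extends ext in
    matching , clear⇒avoids σ matching (λ c → clear c z≤n))
  (λ σ (matching , avoids) → record
    { matching = matching
    ; clear = λ c _ → avoids⇒clear σ matching avoids c
    ; agrees = λ k k≢k → ⊥-elim (k≢k refl)
    ; pending = λ k () })
  (card-stale (2 * n) 0 id [] refl
    (record { involutive = λ _ → refl ; future = λ _ _ → refl ; stack⇒open = λ () ; open⇒stack = λ () ; descending = [] })
    λ ())

theorem5 : (n : ℕ) → 1 ≤ n →
    ((∀ w → InL n w → InP n (τ w))
    × (∀ w w′ → InL n w → InL n w′ → τ w ≡ τ w′ → w ≡ w′)
    × (∀ p → InP n p → ∃[ w ] (InL n w × τ w ≡ p)))
    × (∃[ k ] (HasCard (InL n) k × HasCard (InP n) k × HasCard (InM12312 n) k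
    × suc (2 * n) * k ≡ (3 * n) C n))
theorem5 n _ = (τ-maps n , τ-injective n , τ-surjective n)
  , evenCount (2 * n) 0
  , card-preimage τ (τ-maps n) (τ-injective n) (τ-surjective n) (card-P n)
  , card-P n
  , card-M n
  , evenCount-formula n
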